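{- Let $M$ and $P$ be disjoint finite sets and let $c\notin M\cup P$. Let $(f,M\cup\{c\})$ and $(g,P)$ be polymatroids with $f(\{c\})=g(P)$. Then there is a polymatroid $(r,M\cup P)$ such that for all $A\subseteq M$ and $B\subseteq P$ $$r(A)=f(A),\qquad r(B)=g(B),\qquad r(A\cup P)=f(A\cup\{c\}).$$
   Context: A polymatroid $(f,N)$ on a finite ground set $N$ is a non-negative, monotone, submodular real function $f$ on the subsets of $N$ with $f(\emptyset)=0$. -}

module Defs where

open import Data.Fin.Subset using (Subset; ⊥; _∪_; _∩_; _⊆_)
open import Data.Nat.Base as ℕ using (ℕ)
import Data.Nat.Properties as ℕₚ
open import Data.Product.Base using (∃-syntax; _,_)
open import Data.Rational.Base as ℚ using (ℚ; 0ℚ; ½; ∣_∣)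
import Data.Rational.Properties as ℚₚ
open import Data.Rational.Solver using (module +-*-Solver)
open import Relation.Binary.PropositionalEquality using (_≡_; refl; sym; trans; cong; subst)

IsCauchy : (ℕ → ℚ) → Set
IsCauchy x = ∀ ε → 0ℚ ℚ.< ε →
  ∃[ N ] (∀ m n → N ℕ.≤ m → N ℕ.≤ n → ∣ x m ℚ.- x n ∣ ℚ.< ε)

-- Real numbers as Cauchy sequences of rationals.  There are no quotients here,
-- so equality of reals is the relation _≈_ below and not _≡_.
record ℝ : Set where
  constructor mkℝ
  field
    seq    : ℕ → ℚ
    cauchy : IsCauchy seq

open ℝ public

infix 4 _≈_ _≤_

_≈_ : ℝ → ℝ → Set
x ≈ y = ∀ ε → 0ℚ ℚ.< ε →
  ∃[ N ] (∀ n → N ℕ.≤ n → ∣ seq x n ℚ.- seq y n ∣ ℚ.< ε)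

-- Comparison of limits: the terms need only be ordered eventually and up to
-- an arbitrary ε.
_≤_ : ℝ → ℝ → Set
x ≤ y = ∀ ε → 0ℚ ℚ.< ε →
  ∃[ N ] (∀ n → N ℕ.≤ n → seq x n ℚ.≤ seq y n ℚ.+ ε)

fromℚ : ℚ → ℝ
fromℚ q .seq    _     = q
fromℚ q .cauchy ε 0<ε = 0 , λ _ _ _ _ →
  subst (ℚ._< ε) (sym (cong ∣_∣ (ℚₚ.+-inverseʳ q))) 0<ε

0ℝ : ℝ
0ℝ = fromℚ 0ℚ

private
  0<½*ε : ∀ ε → 0ℚ ℚ.< ε → 0ℚ ℚ.< ½ ℚ.* ε
  0<½*ε ε 0<ε = subst (ℚ._< ½ ℚ.* ε) (ℚₚ.*-zeroʳ ½) (ℚₚ.*-monoʳ-<-pos ½ 0<ε)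

  ½*ε+½*ε≡ε : ∀ ε → ½ ℚ.* ε ℚ.+ ½ ℚ.* ε ≡ ε
  ½*ε+½*ε≡ε ε = trans (sym (ℚₚ.*-distribʳ-+ ε ½ ½)) (ℚₚ.*-identityˡ ε)

  interchange : ∀ a b c d → (a ℚ.+ b) ℚ.- (c ℚ.+ d) ≡ (a ℚ.- c) ℚ.+ (b ℚ.- d)
  interchange = solve 4 (λ a b c d →
    (a :+ b) :- (c :+ d) := (a :- c) :+ (b :- d)) refl
    where open +-*-Solver

infixl 6 _+_

_+_ : ℝ → ℝ → ℝ
(x + y) .seq    n     = seq x n ℚ.+ seq y n
(x + y) .cauchy ε 0<ε
  with N₁ , x-close ← cauchy x (½ ℚ.* ε) (0<½*ε ε 0<ε)
     | N₂ , y-close ← cauchy y (½ ℚ.* ε) (0<½*ε ε 0<ε)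
  = N₁ ℕ.⊔ N₂ , λ m n N≤m N≤n → begin-strict
    ∣ (seq x m ℚ.+ seq y m) ℚ.- (seq x n ℚ.+ seq y n) ∣
      ≡⟨ cong ∣_∣ (interchange (seq x m) (seq y m) (seq x n) (seq y n)) ⟩
    ∣ (seq x m ℚ.- seq x n) ℚ.+ (seq y m ℚ.- seq y n) ∣
      ≤⟨ ℚₚ.∣p+q∣≤∣p∣+∣q∣ (seq x m ℚ.- seq x n) (seq y m ℚ.- seq y n) ⟩
    ∣ seq x m ℚ.- seq x n ∣ ℚ.+ ∣ seq y m ℚ.- seq y n ∣
      <⟨ ℚₚ.+-mono-<
           (x-close m n (ℕₚ.m⊔n≤o⇒m≤o N₁ N₂ N≤m) (ℕₚ.m⊔n≤o⇒m≤o N₁ N₂ N≤n))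
           (y-close m n (ℕₚ.m⊔n≤o⇒n≤o N₁ N₂ N≤m) (ℕₚ.m⊔n≤o⇒n≤o N₁ N₂ N≤n)) ⟩
    ½ ℚ.* ε ℚ.+ ½ ℚ.* ε
      ≡⟨ ½*ε+½*ε≡ε ε ⟩
    ε ∎
  where open ℚₚ.≤-Reasoning

-- The ground set N is a subset of an ambient finite set Fin n.  Only the values
-- of f on subsets of N matter; elsewhere f is unconstrained.
record IsPolymatroid {n : ℕ} (f : Subset n → ℝ) (N : Subset n) : Set where
  field
    empty       : f ⊥ ≈ 0ℝ
    nonNegative : ∀ A → A ⊆ N → 0ℝ ≤ f A
    monotone    : ∀ A B → A ⊆ B → B ⊆ N → f A ≤ f B
    submodular  : ∀ A B → A ⊆ N → B ⊆ N → f (A ∪ B) + f (A ∩ B) ≤ f A + f B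

{-# OPTIONS --safe #-}

-- Put r(A ∪ B) = min (f A + g B) (f (A ∪ c)).  Each of the two functions is
-- submodular, and in the mixed case
--   f A + g B + f (A' ∪ c) ≥ f (A ∪ A' ∪ c) + f (A ∩ A') + g (B ∩ B'),
-- so the minimum is submodular too.  The prescribed values come from
-- f (A ∪ c) ≤ f A + f c = f A + g P and g B ≤ g P = f c.
module Submission where

open import Defs
open import Data.Fin.Base using (Fin)
open import Data.Fin.Subset using (Subset; Empty; ⊥; ⁅_⁆; _∪_; _∩_; _⊆_; _∉_)
open import Data.Fin.Subset.Properties
open import Data.Nat.Base as ℕ using (ℕ)
import Data.Nat.Properties as ℕₚ
open import Data.Product.Base using (Σ-syntax; _×_; _,_)
open import Data.Rational.Base as ℚ using (0ℚ; ½; ∣_∣)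
import Data.Rational.Properties as ℚₚ
open import Data.Rational.Solver using (module +-*-Solver)
open import Data.Sum.Base using (inj₁; inj₂; [_,_]′)
open import Function.Base using (_∘_)
open import Level using (0ℓ)
open import Relation.Binary.Bundles using (Poset)
open import Relation.Binary.PropositionalEquality
  using (_≡_; refl; sym; trans; cong; cong₂; subst; subst₂)
open import Relation.Nullary.Negation using (contradiction)
import Relation.Binary.Reasoning.PartialOrder as PosetReasoning

-- Rational estimates: halving ε, absolute values and minima.

half-pos : ∀ {ε} → 0ℚ ℚ.< ε → 0ℚ ℚ.< ½ ℚ.* ε
half-pos {ε} 0<ε = subst (ℚ._< ½ ℚ.* ε) (ℚₚ.*-zeroʳ ½) (ℚₚ.*-monoʳ-<-pos ½ 0<ε)

half+half : ∀ ε → ½ ℚ.* ε ℚ.+ ½ ℚ.* ε ≡ ε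
half+half ε = trans (sym (ℚₚ.*-distribʳ-+ ε ½ ½)) (ℚₚ.*-identityˡ ε)

half< : ∀ {ε} → 0ℚ ℚ.< ε → ½ ℚ.* ε ℚ.< ε
half< {ε} 0<ε = subst₂ ℚ._<_ (ℚₚ.+-identityʳ _) (half+half ε)
  (ℚₚ.+-monoʳ-< (½ ℚ.* ε) (half-pos 0<ε))

p≤∣p∣ : ∀ p → p ℚ.≤ ∣ p ∣
p≤∣p∣ p with ℚₚ.≤-total 0ℚ p
... | inj₁ 0≤p = ℚₚ.≤-reflexive (sym (ℚₚ.0≤p⇒∣p∣≡p 0≤p))
... | inj₂ p≤0 = ℚₚ.≤-trans p≤0 (ℚₚ.0≤∣p∣ p)

∣p-q∣≡∣q-p∣ : ∀ p q → ∣ p ℚ.- q ∣ ≡ ∣ q ℚ.- p ∣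
∣p-q∣≡∣q-p∣ p q = trans (sym (ℚₚ.∣-p∣≡∣p∣ (p ℚ.- q)))
  (cong ∣_∣ (solve 2 (λ p q → :- (p :- q) := q :- p) refl p q))
  where open +-*-Solver

∣p-q∣<ε⇒p<q+ε : ∀ p q {ε} → ∣ p ℚ.- q ∣ ℚ.< ε → p ℚ.< q ℚ.+ ε
∣p-q∣<ε⇒p<q+ε p q {ε} close = begin-strict
  p                    ≡⟨ solve 2 (λ p q → p := q :+ (p :- q)) refl p q ⟩
  q ℚ.+ (p ℚ.- q)      ≤⟨ ℚₚ.+-monoʳ-≤ q (p≤∣p∣ (p ℚ.- q)) ⟩
  q ℚ.+ ∣ p ℚ.- q ∣    <⟨ ℚₚ.+-monoʳ-< q close ⟩
  q ℚ.+ ε              ∎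
  where open ℚₚ.≤-Reasoning
        open +-*-Solver

p<q+ε⇒p-q<ε : ∀ p q {ε} → p ℚ.< q ℚ.+ ε → p ℚ.- q ℚ.< ε
p<q+ε⇒p-q<ε p q {ε} p<q+ε = begin-strict
  p ℚ.- q              <⟨ ℚₚ.+-monoˡ-< (ℚ.- q) p<q+ε ⟩
  (q ℚ.+ ε) ℚ.- q      ≡⟨ solve 2 (λ q ε → (q :+ ε) :- q := ε) refl q ε ⟩
  ε                    ∎
  where open ℚₚ.≤-Reasoning
        open +-*-Solver

∣p-q∣<ε : ∀ p q {ε} → p ℚ.< q ℚ.+ ε → q ℚ.< p ℚ.+ ε → ∣ p ℚ.- q ∣ ℚ.< ε
∣p-q∣<ε p q {ε} p<q+ε q<p+ε with ℚₚ.∣p∣≡p∨∣p∣≡-p (p ℚ.- q)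
... | inj₁ eq = subst (ℚ._< ε) (sym eq) (p<q+ε⇒p-q<ε p q p<q+ε)
... | inj₂ eq = subst (ℚ._< ε) (sym (trans eq neg)) (p<q+ε⇒p-q<ε q p q<p+ε)
  where
  open +-*-Solver
  neg : ℚ.- (p ℚ.- q) ≡ q ℚ.- p
  neg = solve 2 (λ p q → :- (p :- q) := q :- p) refl p q

-- The minimum on the right is attained by `p′` or by `q′`; the minimum on the left lies below the
-- matching `p` or `q`, so one of the two hypotheses closes each case.
⊓-+-< : ∀ p q {p′ q′ ε} → p ℚ.< p′ ℚ.+ ε → q ℚ.< q′ ℚ.+ ε →
  p ℚ.⊓ q ℚ.< (p′ ℚ.⊓ q′) ℚ.+ ε
⊓-+-< p q {p′} {q′} {ε} p< q< with ℚₚ.⊓-sel p′ q′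
... | inj₁ eq = subst (λ m → p ℚ.⊓ q ℚ.< m ℚ.+ ε) (sym eq)
  (ℚₚ.≤-<-trans (ℚₚ.p⊓q≤p p q) p<)
... | inj₂ eq = subst (λ m → p ℚ.⊓ q ℚ.< m ℚ.+ ε) (sym eq)
  (ℚₚ.≤-<-trans (ℚₚ.p⊓q≤q p q) q<)

-- The order on Cauchy reals.

≤-pointwise : ∀ {x y} → (∀ n → seq x n ℚ.≤ seq y n) → x ≤ y
≤-pointwise {x} {y} x≤y ε 0<ε = 0 , λ n _ → begin
  seq x n              ≤⟨ x≤y n ⟩
  seq y n              ≡⟨ ℚₚ.+-identityʳ _ ⟨
  seq y n ℚ.+ 0ℚ       ≤⟨ ℚₚ.+-monoʳ-≤ (seq y n) (ℚₚ.<⇒≤ 0<ε) ⟩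
  seq y n ℚ.+ ε        ∎
  where open ℚₚ.≤-Reasoning

≤-refl : ∀ {x} → x ≤ x
≤-refl {x} = ≤-pointwise {x} {x} λ n → ℚₚ.≤-refl

≤-trans : ∀ {x y z} → x ≤ y → y ≤ z → x ≤ z
≤-trans {x} {y} {z} x≤y y≤z ε 0<ε
  with N₁ , xy ← x≤y (½ ℚ.* ε) (half-pos 0<ε)
     | N₂ , yz ← y≤z (½ ℚ.* ε) (half-pos 0<ε)
  = N₁ ℕ.⊔ N₂ , λ n N≤n → begin
    seq x n
      ≤⟨ xy n (ℕₚ.m⊔n≤o⇒m≤o N₁ N₂ N≤n) ⟩
    seq y n ℚ.+ ½ ℚ.* ε
      ≤⟨ ℚₚ.+-monoˡ-≤ (½ ℚ.* ε) (yz n (ℕₚ.m⊔n≤o⇒n≤o N₁ N₂ N≤n)) ⟩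
    (seq z n ℚ.+ ½ ℚ.* ε) ℚ.+ ½ ℚ.* ε
      ≡⟨ ℚₚ.+-assoc (seq z n) (½ ℚ.* ε) (½ ℚ.* ε) ⟩
    seq z n ℚ.+ (½ ℚ.* ε ℚ.+ ½ ℚ.* ε)
      ≡⟨ cong (seq z n ℚ.+_) (half+half ε) ⟩
    seq z n ℚ.+ ε ∎
  where open ℚₚ.≤-Reasoning

≤-antisym : ∀ {x y} → x ≤ y → y ≤ x → x ≈ y
≤-antisym {x} {y} x≤y y≤x ε 0<ε
  with N₁ , xy ← x≤y (½ ℚ.* ε) (half-pos 0<ε)
     | N₂ , yx ← y≤x (½ ℚ.* ε) (half-pos 0<ε)
  = N₁ ℕ.⊔ N₂ , λ n N≤n → ∣p-q∣<ε (seq x n) (seq y n)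
      -- `_≤_` bounds the terms weakly but `_≈_` asks for a strict bound; the gap between half of ε
      -- and ε supplies the strictness.
      (ℚₚ.≤-<-trans (xy n (ℕₚ.m⊔n≤o⇒m≤o N₁ N₂ N≤n)) (ℚₚ.+-monoʳ-< (seq y n) (half< 0<ε)))
      (ℚₚ.≤-<-trans (yx n (ℕₚ.m⊔n≤o⇒n≤o N₁ N₂ N≤n)) (ℚₚ.+-monoʳ-< (seq x n) (half< 0<ε)))

≈-sym : ∀ {x y} → x ≈ y → y ≈ x
≈-sym {x} {y} x≈y ε 0<ε with N , close ← x≈y ε 0<ε =
  N , λ n N≤n → subst (ℚ._< ε) (∣p-q∣≡∣q-p∣ (seq x n) (seq y n)) (close n N≤n)

≤-reflexive : ∀ {x y} → x ≈ y → x ≤ y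
≤-reflexive {x} {y} x≈y ε 0<ε with N , close ← x≈y ε 0<ε =
  N , λ n N≤n → ℚₚ.<⇒≤ (∣p-q∣<ε⇒p<q+ε (seq x n) (seq y n) (close n N≤n))

≤-reflexive˘ : ∀ {x y} → x ≈ y → y ≤ x
≤-reflexive˘ {x} {y} x≈y = ≤-reflexive {y} {x} (≈-sym {x} {y} x≈y)

-- Makes equational chains available for `_≈_` and `_≤_`. Implicit reals are mostly passed by hand
-- because both relations unfold to statements about `seq`, from which the field `cauchy` cannot be
-- inferred.
≤-poset : Poset 0ℓ 0ℓ 0ℓ
≤-poset = record
  { Carrier = ℝ
  ; _≈_     = _≈_
  ; _≤_     = _≤_
  ; isPartialOrder = record
    { isPreorder = record
      { isEquivalence = record
        { refl  = λ {x} → ≤-antisym {x} {x} (≤-refl {x}) (≤-refl {x})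
        ; sym   = λ {x} {y} → ≈-sym {x} {y}
        ; trans = λ {x} {y} {z} x≈y y≈z → ≤-antisym {x} {z}
            (≤-trans {x} {y} {z} (≤-reflexive {x} {y} x≈y) (≤-reflexive {y} {z} y≈z))
            (≤-trans {z} {y} {x} (≤-reflexive˘ {y} {z} y≈z) (≤-reflexive˘ {x} {y} x≈y))
        }
      ; reflexive = λ {x} {y} → ≤-reflexive {x} {y}
      ; trans     = λ {x} {y} {z} → ≤-trans {x} {y} {z}
      }
    ; antisym = λ {x} {y} → ≤-antisym {x} {y}
    }
  }

module ≤-Reasoning = PosetReasoning ≤-poset

-- Addition of reals: laws inherited termwise from the rationals.

≈-pointwise : ∀ x y → (∀ n → seq x n ≡ seq y n) → x ≈ y
≈-pointwise x y x≡y = ≤-antisym {x} {y}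
  (≤-pointwise {x} {y} (λ n → ℚₚ.≤-reflexive (x≡y n)))
  (≤-pointwise {y} {x} (λ n → ℚₚ.≤-reflexive (sym (x≡y n))))

+-identityʳ : ∀ x → x + 0ℝ ≈ x
+-identityʳ x = ≈-pointwise (x + 0ℝ) x λ n → ℚₚ.+-identityʳ (seq x n)

+-comm : ∀ x y → x + y ≈ y + x
+-comm x y = ≈-pointwise (x + y) (y + x) λ n → ℚₚ.+-comm (seq x n) (seq y n)

+-assoc : ∀ x y z → (x + y) + z ≈ x + (y + z)
+-assoc x y z = ≈-pointwise ((x + y) + z) (x + (y + z)) λ n →
  ℚₚ.+-assoc (seq x n) (seq y n) (seq z n)

+-interchange : ∀ x y z w → (x + y) + (z + w) ≈ (x + z) + (y + w)
+-interchange x y z w = ≈-pointwise ((x + y) + (z + w)) ((x + z) + (y + w)) λ n →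
  solve 4 (λ x y z w → (x :+ y) :+ (z :+ w) := (x :+ z) :+ (y :+ w)) refl
    (seq x n) (seq y n) (seq z n) (seq w n)
  where open +-*-Solver

+-monoˡ-≤ : ∀ z {x y} → x ≤ y → x + z ≤ y + z
+-monoˡ-≤ z {x} {y} x≤y ε 0<ε with N , xy ← x≤y ε 0<ε =
  N , λ n N≤n → begin
    seq x n ℚ.+ seq z n            ≤⟨ ℚₚ.+-monoˡ-≤ (seq z n) (xy n N≤n) ⟩
    (seq y n ℚ.+ ε) ℚ.+ seq z n    ≡⟨ swap (seq y n) ε (seq z n) ⟩
    (seq y n ℚ.+ seq z n) ℚ.+ ε    ∎
  where
  open ℚₚ.≤-Reasoning
  open +-*-Solver
  swap : ∀ p q r → (p ℚ.+ q) ℚ.+ r ≡ (p ℚ.+ r) ℚ.+ q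
  swap = solve 3 (λ p q r → (p :+ q) :+ r := (p :+ r) :+ q) refl

+-mono-≤ : ∀ {x y z w} → x ≤ y → z ≤ w → x + z ≤ y + w
+-mono-≤ {x} {y} {z} {w} x≤y z≤w = begin
  x + z    ≤⟨ +-monoˡ-≤ z {x} {y} x≤y ⟩
  y + z    ≈⟨ +-comm y z ⟩
  z + y    ≤⟨ +-monoˡ-≤ y {z} {w} z≤w ⟩
  w + y    ≈⟨ +-comm w y ⟩
  y + w    ∎
  where open ≤-Reasoning

+-monoʳ-≤ : ∀ z {x y} → x ≤ y → z + x ≤ z + y
+-monoʳ-≤ z {x} {y} = +-mono-≤ {z} {z} {x} {y} (≤-refl {z})

-- Minimum of reals.

infixl 7 _⊓_

-- Reals cannot be compared by a decision, so the minimum is taken term by term. If both arguments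
-- move by less than ε then so does the minimum, hence no halving as in `_+_`.
_⊓_ : ℝ → ℝ → ℝ
(x ⊓ y) .seq    n = seq x n ℚ.⊓ seq y n
(x ⊓ y) .cauchy ε 0<ε
  with N₁ , x-close ← cauchy x ε 0<ε
     | N₂ , y-close ← cauchy y ε 0<ε
  = N₁ ℕ.⊔ N₂ , λ m n N≤m N≤n →
      ∣p-q∣<ε (seq x m ℚ.⊓ seq y m) (seq x n ℚ.⊓ seq y n)
        (below N≤m N≤n) (below N≤n N≤m)
  where
  below : ∀ {m n} → N₁ ℕ.⊔ N₂ ℕ.≤ m → N₁ ℕ.⊔ N₂ ℕ.≤ n →
    seq x m ℚ.⊓ seq y m ℚ.< (seq x n ℚ.⊓ seq y n) ℚ.+ ε
  below {m} {n} N≤m N≤n = ⊓-+-< (seq x m) (seq y m) {seq x n} {seq y n}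
    (∣p-q∣<ε⇒p<q+ε (seq x m) (seq x n)
      (x-close m n (ℕₚ.m⊔n≤o⇒m≤o N₁ N₂ N≤m) (ℕₚ.m⊔n≤o⇒m≤o N₁ N₂ N≤n)))
    (∣p-q∣<ε⇒p<q+ε (seq y m) (seq y n)
      (y-close m n (ℕₚ.m⊔n≤o⇒n≤o N₁ N₂ N≤m) (ℕₚ.m⊔n≤o⇒n≤o N₁ N₂ N≤n)))

x⊓y≤x : ∀ x y → x ⊓ y ≤ x
x⊓y≤x x y = ≤-pointwise {x ⊓ y} {x} λ n → ℚₚ.p⊓q≤p (seq x n) (seq y n)

x⊓y≤y : ∀ x y → x ⊓ y ≤ y
x⊓y≤y x y = ≤-pointwise {x ⊓ y} {y} λ n → ℚₚ.p⊓q≤q (seq x n) (seq y n)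

-- At each index the rational minimum equals one of its two terms. Which one may change with the
-- index, so both bounds must already hold there, which is the case beyond `N₁ ℕ.⊔ N₂`.
⊓-glb-+ : ∀ z x y w → z ≤ x + w → z ≤ y + w → z ≤ x ⊓ y + w
⊓-glb-+ z x y w z≤x+w z≤y+w ε 0<ε
  with N₁ , zx ← z≤x+w ε 0<ε
     | N₂ , zy ← z≤y+w ε 0<ε
  = N₁ ℕ.⊔ N₂ , below
  where
  below : ∀ n → N₁ ℕ.⊔ N₂ ℕ.≤ n →
    seq z n ℚ.≤ (seq x n ℚ.⊓ seq y n ℚ.+ seq w n) ℚ.+ ε
  below n N≤n with ℚₚ.⊓-sel (seq x n) (seq y n)
  ... | inj₁ eq = subst (λ m → seq z n ℚ.≤ (m ℚ.+ seq w n) ℚ.+ ε) (sym eq)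
    (zx n (ℕₚ.m⊔n≤o⇒m≤o N₁ N₂ N≤n))
  ... | inj₂ eq = subst (λ m → seq z n ℚ.≤ (m ℚ.+ seq w n) ℚ.+ ε) (sym eq)
    (zy n (ℕₚ.m⊔n≤o⇒n≤o N₁ N₂ N≤n))

⊓-glb : ∀ z x y → z ≤ x → z ≤ y → z ≤ x ⊓ y
⊓-glb z x y z≤x z≤y = begin
  z             ≤⟨ ⊓-glb-+ z x y 0ℝ (+0 x z≤x) (+0 y z≤y) ⟩
  x ⊓ y + 0ℝ    ≈⟨ +-identityʳ (x ⊓ y) ⟩
  x ⊓ y         ∎
  where
  open ≤-Reasoning
  +0 : ∀ x → z ≤ x → z ≤ x + 0ℝ
  +0 x z≤x = ≤-trans {z} {x} {x + 0ℝ} z≤x (≤-reflexive˘ {x + 0ℝ} {x} (+-identityʳ x))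

-- Replaces the case analysis on which function attains each minimum: a bound by a sum of two minima
-- is split into four bounds, by `⊓-glb-+` on each summand in turn.
⊓-+-⊓-glb : ∀ z a b c d →
  z ≤ a + c → z ≤ a + d → z ≤ b + c → z ≤ b + d → z ≤ a ⊓ b + c ⊓ d
⊓-+-⊓-glb z a b c d z≤a+c z≤a+d z≤b+c z≤b+d =
  ⊓-glb-+ z a b (c ⊓ d) (right a z≤a+c z≤a+d) (right b z≤b+c z≤b+d)
  where
  swap : ∀ x y → z ≤ x + y → z ≤ y + x
  swap x y z≤ = ≤-trans {z} {x + y} {y + x} z≤ (≤-reflexive {x + y} {y + x} (+-comm x y))
  right : ∀ x → z ≤ x + c → z ≤ x + d → z ≤ x + c ⊓ d
  right x z≤x+c z≤x+d = swap (c ⊓ d) x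
    (⊓-glb-+ z c d x (swap x c z≤x+c) (swap x d z≤x+d))

⊓-mono-≤ : ∀ {x y z w} → x ≤ y → z ≤ w → x ⊓ z ≤ y ⊓ w
⊓-mono-≤ {x} {y} {z} {w} x≤y z≤w = ⊓-glb (x ⊓ z) y w
  (≤-trans {x ⊓ z} {x} {y} (x⊓y≤x x z) x≤y)
  (≤-trans {x ⊓ z} {z} {w} (x⊓y≤y x z) z≤w)

-- Lattice facts about finite subsets.

module _ {n : ℕ} where

  ∪-lub : {A B C : Subset n} → A ⊆ C → B ⊆ C → A ∪ B ⊆ C
  ∪-lub {A} {B} A⊆C B⊆C x∈A∪B = [ A⊆C , B⊆C ]′ (x∈p∪q⁻ A B x∈A∪B)

  ∩-glb : {A B C : Subset n} → C ⊆ A → C ⊆ B → C ⊆ A ∩ B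
  ∩-glb C⊆A C⊆B x∈C = x∈p∩q⁺ (C⊆A x∈C , C⊆B x∈C)

  ∪-mono : {A B C D : Subset n} → A ⊆ B → C ⊆ D → A ∪ C ⊆ B ∪ D
  ∪-mono {B = B} {D = D} A⊆B C⊆D = ∪-lub (p⊆p∪q D ∘ A⊆B) (q⊆p∪q B D ∘ C⊆D)

  ∩-mono : {A B C D : Subset n} → A ⊆ B → C ⊆ D → A ∩ C ⊆ B ∩ D
  ∩-mono {A} {C = C} A⊆B C⊆D = ∩-glb (A⊆B ∘ p∩q⊆p A C) (C⊆D ∘ p∩q⊆q A C)

  -- A point of `B` inside `M` would lie in `M ∩ P`. This recovers the two pieces of a union from
  -- its traces.
  ∪-restrict : {M P A B : Subset n} → Empty (M ∩ P) → A ⊆ M → B ⊆ P →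
    (A ∪ B) ∩ M ≡ A
  ∪-restrict {M} {P} {A} {B} M∩P≡∅ A⊆M B⊆P = ⊆-antisym ⊆A (∩-glb (p⊆p∪q B) A⊆M)
    where
    ⊆A : (A ∪ B) ∩ M ⊆ A
    ⊆A {x} x∈ with x∈p∩q⁻ (A ∪ B) M x∈
    ... | x∈A∪B , x∈M with x∈p∪q⁻ A B x∈A∪B
    ...   | inj₁ x∈A = x∈A
    ...   | inj₂ x∈B = contradiction (x , x∈p∩q⁺ (x∈M , B⊆P x∈B)) M∩P≡∅

-- Monotonicity is built into submodularity here, so that later uses only need inclusions and never
-- have to compute a union or an intersection exactly.
submodular-⊆ : ∀ {n} {f : Subset n → ℝ} {N} → IsPolymatroid f N →
  ∀ U V A B → A ⊆ N → B ⊆ N → U ⊆ A ∪ B → V ⊆ A ∩ B → f U + f V ≤ f A + f B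
submodular-⊆ {f = f} {N} isPoly U V A B A⊆N B⊆N U⊆ V⊆ = begin
  f U + f V              ≤⟨ +-mono-≤ {f U} {f (A ∪ B)} {f V} {f (A ∩ B)}
                              (monotone U (A ∪ B) U⊆ (∪-lub A⊆N B⊆N))
                              (monotone V (A ∩ B) V⊆ (A⊆N ∘ p∩q⊆p A B)) ⟩
  f (A ∪ B) + f (A ∩ B)  ≤⟨ submodular A B A⊆N B⊆N ⟩
  f A + f B              ∎
  where
  open IsPolymatroid isPoly
  open ≤-Reasoning

-- The minimum of the two functions, with a set `C` in the role of the single element.

module Expansion {n : ℕ} {M C P : Subset n} {f g : Subset n → ℝ}
  (f-poly : IsPolymatroid f (M ∪ C)) (g-poly : IsPolymatroid g P)
  (fC≈gP : f C ≈ g P) where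

  private
    module F = IsPolymatroid f-poly
    module G = IsPolymatroid g-poly

  open ≤-Reasoning

  -- The pair `A`, `B` stands for the set `A ∪ B`. Keeping the pieces apart lets the inequalities be
  -- proved coordinatewise; disjointness of `M` and `P` enters only when pairs are turned into sets.
  value : Subset n → Subset n → ℝ
  value A B = (f A + g B) ⊓ f (A ∪ C)

  private
    wide : ∀ {A} → A ⊆ M → A ⊆ M ∪ C
    wide A⊆M = p⊆p∪q C ∘ A⊆M

    wideC : ∀ {A} → A ⊆ M → A ∪ C ⊆ M ∪ C
    wideC A⊆M = ∪-mono A⊆M ⊆-refl

    C⊆M∪C : C ⊆ M ∪ C
    C⊆M∪C = q⊆p∪q M C

  value-nonNegative : ∀ A B → A ⊆ M → B ⊆ P → 0ℝ ≤ value A B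
  value-nonNegative A B A⊆M B⊆P = ⊓-glb 0ℝ (f A + g B) (f (A ∪ C))
    (begin
      0ℝ           ≈⟨ +-identityʳ 0ℝ ⟨
      0ℝ + 0ℝ      ≤⟨ +-mono-≤ {0ℝ} {f A} {0ℝ} {g B}
                        (F.nonNegative A (wide A⊆M)) (G.nonNegative B B⊆P) ⟩
      f A + g B    ∎)
    (F.nonNegative (A ∪ C) (wideC A⊆M))

  value-mono : ∀ A A′ B B′ → A ⊆ A′ → A′ ⊆ M → B ⊆ B′ → B′ ⊆ P →
    value A B ≤ value A′ B′
  value-mono A A′ B B′ A⊆A′ A′⊆M B⊆B′ B′⊆P =
    ⊓-mono-≤ {f A + g B} {f A′ + g B′} {f (A ∪ C)} {f (A′ ∪ C)}
      (+-mono-≤ {f A} {f A′} {g B} {g B′}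
        (F.monotone A A′ A⊆A′ (wide A′⊆M)) (G.monotone B B′ B⊆B′ B′⊆P))
      (F.monotone (A ∪ C) (A′ ∪ C) (∪-mono A⊆A′ ⊆-refl) (wideC A′⊆M))

  -- Each minimum on the right may be attained by either function, which gives four cases. In each
  -- of them the minima on the left are bounded by whichever function suits the case.
  value-submodular : ∀ A A′ U V B B′ X Y →
    A ⊆ M → A′ ⊆ M → B ⊆ P → B′ ⊆ P →
    U ⊆ A ∪ A′ → V ⊆ A ∩ A′ → X ⊆ B ∪ B′ → Y ⊆ B ∩ B′ →
    value U X + value V Y ≤ value A B + value A′ B′
  value-submodular A A′ U V B B′ X Y
    A⊆M A′⊆M B⊆P B′⊆P U⊆ V⊆ X⊆ Y⊆ =
    ⊓-+-⊓-glb (value U X + value V Y) (f A + g B) (f (A ∪ C)) (f A′ + g B′) (f (A′ ∪ C))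
      -- Sum and sum: submodularity of `f` and of `g` separately.
      (begin
        value U X + value V Y
          ≤⟨ +-mono-≤ {value U X} {f U + g X} {value V Y} {f V + g Y}
               (x⊓y≤x (f U + g X) (f (U ∪ C))) (x⊓y≤x (f V + g Y) (f (V ∪ C))) ⟩
        (f U + g X) + (f V + g Y)
          ≈⟨ +-interchange (f U) (g X) (f V) (g Y) ⟩
        (f U + f V) + (g X + g Y)
          ≤⟨ +-mono-≤ {f U + f V} {f A + f A′} {g X + g Y} {g B + g B′}
               (submodular-⊆ f-poly U V A A′ (wide A⊆M) (wide A′⊆M) U⊆ V⊆)
               (submodular-⊆ g-poly X Y B B′ B⊆P B′⊆P X⊆ Y⊆) ⟩
        (f A + f A′) + (g B + g B′)
          ≈⟨ +-interchange (f A) (f A′) (g B) (g B′) ⟩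
        (f A + g B) + (f A′ + g B′) ∎)
      -- Sum and cap: submodularity of `f` at `A` and `A′ ∪ C`, whose union contains `U ∪ C` and
      -- whose intersection contains `V`. Only `g Y` remains, and `Y ⊆ B`.
      (begin
        value U X + value V Y
          ≤⟨ mixed ⟩
        (f (U ∪ C) + f V) + g Y
          ≤⟨ +-mono-≤ {f (U ∪ C) + f V} {f A + f (A′ ∪ C)} {g Y} {g B}
               (submodular-⊆ f-poly (U ∪ C) V A (A′ ∪ C) (wide A⊆M) (wideC A′⊆M)
                 (∪-lub (∪-mono ⊆-refl (p⊆p∪q C) ∘ U⊆) (q⊆p∪q A (A′ ∪ C) ∘ q⊆p∪q A′ C))
                 (∩-mono ⊆-refl (p⊆p∪q C) ∘ V⊆))
               (G.monotone Y B (p∩q⊆p B B′ ∘ Y⊆) B⊆P) ⟩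
        (f A + f (A′ ∪ C)) + g B
          ≈⟨ +-assoc (f A) (f (A′ ∪ C)) (g B) ⟩
        f A + (f (A′ ∪ C) + g B)
          ≤⟨ +-monoʳ-≤ (f A) {f (A′ ∪ C) + g B} {g B + f (A′ ∪ C)}
               (≤-reflexive {f (A′ ∪ C) + g B} {g B + f (A′ ∪ C)}
                 (+-comm (f (A′ ∪ C)) (g B))) ⟩
        f A + (g B + f (A′ ∪ C))
          ≈⟨ +-assoc (f A) (g B) (f (A′ ∪ C)) ⟨
        (f A + g B) + f (A′ ∪ C) ∎)
      -- The mirror image, with `C` joined to `A` and with `Y ⊆ B′`.
      (begin
        value U X + value V Y
          ≤⟨ mixed ⟩
        (f (U ∪ C) + f V) + g Y
          ≤⟨ +-mono-≤ {f (U ∪ C) + f V} {f (A ∪ C) + f A′} {g Y} {g B′}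
               (submodular-⊆ f-poly (U ∪ C) V (A ∪ C) A′ (wideC A⊆M) (wide A′⊆M)
                 (∪-lub (∪-mono (p⊆p∪q C) ⊆-refl ∘ U⊆) (p⊆p∪q A′ ∘ q⊆p∪q A C))
                 (∩-mono (p⊆p∪q C) ⊆-refl ∘ V⊆))
               (G.monotone Y B′ (p∩q⊆q B B′ ∘ Y⊆) B′⊆P) ⟩
        (f (A ∪ C) + f A′) + g B′
          ≈⟨ +-assoc (f (A ∪ C)) (f A′) (g B′) ⟩
        f (A ∪ C) + (f A′ + g B′) ∎)
      -- Cap and cap: `C` lies in both sets, hence also in their intersection, and submodularity of
      -- `f` suffices.
      (begin
        value U X + value V Y
          ≤⟨ +-mono-≤ {value U X} {f (U ∪ C)} {value V Y} {f (V ∪ C)}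
               (x⊓y≤y (f U + g X) (f (U ∪ C))) (x⊓y≤y (f V + g Y) (f (V ∪ C))) ⟩
        f (U ∪ C) + f (V ∪ C)
          ≤⟨ submodular-⊆ f-poly (U ∪ C) (V ∪ C) (A ∪ C) (A′ ∪ C) (wideC A⊆M) (wideC A′⊆M)
               (∪-lub (∪-mono (p⊆p∪q C) (p⊆p∪q C) ∘ U⊆) (p⊆p∪q (A′ ∪ C) ∘ q⊆p∪q A C))
               (∩-glb (∪-mono (p∩q⊆p A A′ ∘ V⊆) ⊆-refl)
                      (∪-mono (p∩q⊆q A A′ ∘ V⊆) ⊆-refl)) ⟩
        f (A ∪ C) + f (A′ ∪ C) ∎)
    where
    -- Shared by both mixed cases: the pair below the union takes the cap, the pair below the
    -- intersection takes the sum, and the two `f` terms are brought together.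
    mixed : value U X + value V Y ≤ (f (U ∪ C) + f V) + g Y
    mixed = begin
      value U X + value V Y
        ≤⟨ +-mono-≤ {value U X} {f (U ∪ C)} {value V Y} {f V + g Y}
             (x⊓y≤y (f U + g X) (f (U ∪ C))) (x⊓y≤x (f V + g Y) (f (V ∪ C))) ⟩
      f (U ∪ C) + (f V + g Y)
        ≈⟨ +-assoc (f (U ∪ C)) (f V) (g Y) ⟨
      (f (U ∪ C) + f V) + g Y ∎

  -- Since `g ⊥` vanishes, the sum is `f A`, and by monotonicity the cap `f (A ∪ C)` does not cut
  -- below it.
  value-A-⊥ : ∀ A → A ⊆ M → value A ⊥ ≈ f A
  value-A-⊥ A A⊆M = ≤-antisym {value A ⊥} {f A}
    (begin
      value A ⊥    ≤⟨ x⊓y≤x (f A + g ⊥) (f (A ∪ C)) ⟩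
      f A + g ⊥    ≤⟨ +-monoʳ-≤ (f A) {g ⊥} {0ℝ} (≤-reflexive {g ⊥} {0ℝ} G.empty) ⟩
      f A + 0ℝ     ≈⟨ +-identityʳ (f A) ⟩
      f A          ∎)
    (⊓-glb (f A) (f A + g ⊥) (f (A ∪ C))
      (begin
        f A          ≈⟨ +-identityʳ (f A) ⟨
        f A + 0ℝ     ≤⟨ +-monoʳ-≤ (f A) {0ℝ} {g ⊥} (G.nonNegative ⊥ ⊥⊆) ⟩
        f A + g ⊥    ∎)
      (F.monotone A (A ∪ C) (p⊆p∪q C) (wideC A⊆M)))

  value-⊥-B : ∀ B → B ⊆ P → value ⊥ B ≈ g B
  value-⊥-B B B⊆P = ≤-antisym {value ⊥ B} {g B}
    (begin
      value ⊥ B    ≤⟨ x⊓y≤x (f ⊥ + g B) (f (⊥ ∪ C)) ⟩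
      f ⊥ + g B    ≈⟨ +-comm (f ⊥) (g B) ⟩
      g B + f ⊥    ≤⟨ +-monoʳ-≤ (g B) {f ⊥} {0ℝ} (≤-reflexive {f ⊥} {0ℝ} F.empty) ⟩
      g B + 0ℝ     ≈⟨ +-identityʳ (g B) ⟩
      g B          ∎)
    (⊓-glb (g B) (f ⊥ + g B) (f (⊥ ∪ C))
      (begin
        g B          ≈⟨ +-identityʳ (g B) ⟨
        g B + 0ℝ     ≤⟨ +-monoʳ-≤ (g B) {0ℝ} {f ⊥} (F.nonNegative ⊥ ⊥⊆) ⟩
        g B + f ⊥    ≈⟨ +-comm (g B) (f ⊥) ⟩
        f ⊥ + g B    ∎)
      -- The cap does not cut below `g B`: this is where `f C ≈ g P` enters on this side.
      (begin
        g B          ≤⟨ G.monotone B P B⊆P ⊆-refl ⟩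
        g P          ≈⟨ fC≈gP ⟨
        f C          ≤⟨ F.monotone C (⊥ ∪ C) (q⊆p∪q ⊥ C) (wideC ⊥⊆) ⟩
        f (⊥ ∪ C)    ∎))

  value-A-P : ∀ A → A ⊆ M → value A P ≈ f (A ∪ C)
  value-A-P A A⊆M = ≤-antisym {value A P} {f (A ∪ C)}
    (x⊓y≤y (f A + g P) (f (A ∪ C)))
    (⊓-glb (f (A ∪ C)) (f A + g P) (f (A ∪ C))
      (begin
        f (A ∪ C)          ≈⟨ +-identityʳ (f (A ∪ C)) ⟨
        -- Subadditivity from submodularity: `⊥` serves as the lower set, lying inside `A ∩ C` and
        -- having non-negative value.
        f (A ∪ C) + 0ℝ     ≤⟨ +-monoʳ-≤ (f (A ∪ C)) {0ℝ} {f ⊥} (F.nonNegative ⊥ ⊥⊆) ⟩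
        f (A ∪ C) + f ⊥    ≤⟨ submodular-⊆ f-poly (A ∪ C) ⊥ A C (wide A⊆M) C⊆M∪C ⊆-refl ⊥⊆ ⟩
        f A + f C          ≤⟨ +-monoʳ-≤ (f A) {f C} {g P} (≤-reflexive {f C} {g P} fC≈gP) ⟩
        f A + g P          ∎)
      (≤-refl {f (A ∪ C)}))

  -- From pairs of pieces to subsets of `M ∪ P`, through the traces on `M` and `P`.

  rank : Subset n → ℝ
  rank S = value (S ∩ M) (S ∩ P)

  module _ (M∩P≡∅ : Empty (M ∩ P)) where

    -- Disjointness makes the traces of `A ∪ B` equal to `A` and `B`; for the second trace the roles
    -- of `M` and `P` are exchanged. All prescribed values are read off through this equation, with
    -- `⊥` as the missing piece where needed.
    rank-∪ : ∀ A B → A ⊆ M → B ⊆ P → rank (A ∪ B) ≡ value A B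
    rank-∪ A B A⊆M B⊆P = cong₂ value (∪-restrict M∩P≡∅ A⊆M B⊆P)
      (trans (cong (_∩ P) (∪-comm A B))
        (∪-restrict (subst Empty (∩-comm M P) M∩P≡∅) B⊆P A⊆M))

    rank-A : ∀ A → A ⊆ M → rank A ≈ f A
    rank-A A A⊆M = subst (λ S → rank S ≈ f A) (∪-identityʳ A)
      (subst (_≈ f A) (sym (rank-∪ A ⊥ A⊆M ⊥⊆)) (value-A-⊥ A A⊆M))

    rank-B : ∀ B → B ⊆ P → rank B ≈ g B
    rank-B B B⊆P = subst (λ S → rank S ≈ g B) (∪-identityˡ B)
      (subst (_≈ g B) (sym (rank-∪ ⊥ B ⊥⊆ B⊆P)) (value-⊥-B B B⊆P))

    rank-A∪P : ∀ A → A ⊆ M → rank (A ∪ P) ≈ f (A ∪ C)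
    rank-A∪P A A⊆M =
      subst (_≈ f (A ∪ C)) (sym (rank-∪ A P A⊆M ⊆-refl)) (value-A-P A A⊆M)

    rank-isPolymatroid : IsPolymatroid rank (M ∪ P)
    rank-isPolymatroid = record
      -- `⊥` is a subset of `M`, so its rank is already known to be `f ⊥`.
      { empty       = begin-equality
          rank ⊥  ≈⟨ rank-A ⊥ ⊥⊆ ⟩
          f ⊥     ≈⟨ F.empty ⟩
          0ℝ      ∎
      ; nonNegative = λ A _ → value-nonNegative (A ∩ M) (A ∩ P) (p∩q⊆q A M) (p∩q⊆q A P)
      ; monotone    = λ A B A⊆B _ → value-mono (A ∩ M) (B ∩ M) (A ∩ P) (B ∩ P)
          (∩-mono A⊆B ⊆-refl) (p∩q⊆q B M) (∩-mono A⊆B ⊆-refl) (p∩q⊆q B P)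
      ; submodular  = λ A B _ _ → value-submodular
          (A ∩ M) (B ∩ M) ((A ∪ B) ∩ M) ((A ∩ B) ∩ M)
          (A ∩ P) (B ∩ P) ((A ∪ B) ∩ P) ((A ∩ B) ∩ P)
          (p∩q⊆q A M) (p∩q⊆q B M) (p∩q⊆q A P) (p∩q⊆q B P)
          -- Taking traces commutes with unions by distributivity; for intersections one inclusion
          -- is enough.
          (⊆-reflexive (∩-distribʳ-∪ M A B)) (restrict-∩ A B M)
          (⊆-reflexive (∩-distribʳ-∪ P A B)) (restrict-∩ A B P)
      }
      where
      restrict-∩ : ∀ A B N → (A ∩ B) ∩ N ⊆ (A ∩ N) ∩ (B ∩ N)
      restrict-∩ A B N = ∩-glb (∩-mono (p∩q⊆p A B) ⊆-refl) (∩-mono (p∩q⊆q A B) ⊆-refl)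

theorem14 : (n : ℕ) (M P : Subset n) (c : Fin n) →
    Empty (M ∩ P) → c ∉ M ∪ P →
    (f g : Subset n → ℝ) →
    IsPolymatroid f (M ∪ ⁅ c ⁆) → IsPolymatroid g P →
    f ⁅ c ⁆ ≈ g P →
    Σ[ r ∈ (Subset n → ℝ) ]
      (IsPolymatroid r (M ∪ P) ×
       ((A B : Subset n) → A ⊆ M → B ⊆ P →
         (r A ≈ f A) × (r B ≈ g B) × (r (A ∪ P) ≈ f (A ∪ ⁅ c ⁆))))
theorem14 n M P c M∩P≡∅ _ f g f-poly g-poly fc≈gP =
  rank , rank-isPolymatroid M∩P≡∅ , λ A B A⊆M B⊆P →
    rank-A M∩P≡∅ A A⊆M , rank-B M∩P≡∅ B B⊆P , rank-A∪P M∩P≡∅ A A⊆M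
  where open Expansion f-poly g-poly fc≈gP
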